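{- Let $R$ be a commutative ring with unit. If $G$ is a totally ordered monoid (not necessarily commutative), then under the natural addition and multiplication, the set $R_w[G]$ of Malcev-Neumann series on $G$ with coefficients in $R$ is a ring.
   Context: A totally ordered monoid is a monoid $G$ with a total ordering $\le$ such that $x<y$ implies $zx<zy$ and $xz<yz$ for all $x,y,z\in G$. A Malcev-Neumann series is a formal series $\eta=\sum_{g\in G}a_gg$ with $a_g\in R$ whose support $\{g\in G:a_g\neq0\}$ is a well-ordered subset of $G$ (every nonempty subset has a least element). Addition is coefficientwise, and multiplication extends that of $G$ linearly. -}

module Defs where

open import Level using (Level; _⊔_; suc)
open import Algebra.Bundles using (CommutativeRing)
open import Algebra.Core using (Op₂)
open import Algebra.Structures using (IsMonoid)
open import Data.List.Base using (List; foldr; map)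
open import Data.Product.Base using (_×_; _,_; ∃-syntax)
open import Data.Product.Relation.Binary.Pointwise.NonDependent using (×-setoid)
open import Function.Bundles using (_⇔_)
open import Relation.Binary.Bundles using (Setoid)
open import Relation.Binary.Core using (Rel; _Preserves_⟶_)
open import Relation.Binary.Structures using (IsTotalOrder)
import Data.List.Membership.Setoid as Membership
import Data.List.Relation.Unary.Unique.Setoid as Uniqueness
import Relation.Binary.Construct.NonStrictToStrict as ToStrict
open import Relation.Nullary.Negation using (¬_)
open import Relation.Unary using (Pred; _∈_; _⊆_; Satisfiable)

record TotallyOrderedMonoid g ℓ₁ ℓ₂ : Set (suc (g ⊔ ℓ₁ ⊔ ℓ₂)) where
  infixl 7 _∙_
  infix  4 _≈_ _≤_
  field
    Carrier      : Set g
    _≈_          : Rel Carrier ℓ₁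
    _≤_          : Rel Carrier ℓ₂
    _∙_          : Op₂ Carrier
    ε            : Carrier
    isMonoid     : IsMonoid _≈_ _∙_ ε
    isTotalOrder : IsTotalOrder _≈_ _≤_

  open ToStrict _≈_ _≤_ public using (_<_)

  field
    ∙-monoʳ-<    : ∀ z → (λ x → z ∙ x) Preserves _<_ ⟶ _<_
    ∙-monoˡ-<    : ∀ z → (λ x → x ∙ z) Preserves _<_ ⟶ _<_

  setoid : Setoid g ℓ₁
  setoid = record { isEquivalence = IsMonoid.isEquivalence isMonoid }

module MalcevNeumann {c ℓ g ℓ₁ ℓ₂ : Level}
  (R : CommutativeRing c ℓ) (G : TotallyOrderedMonoid g ℓ₁ ℓ₂) where

  private
    module R = CommutativeRing R
    module G = TotallyOrderedMonoid G

    -- The level of the subsets over which "every nonempty subset" ranges: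
    -- large enough to include every subset definable from elements of R
    -- and G.  Under excluded middle at this level, every subset is
    -- equivalent to one at any other level.
    p : Level
    p = c ⊔ ℓ ⊔ g ⊔ ℓ₁ ⊔ ℓ₂

  IsWellOrdered : ∀ {s} → Pred G.Carrier s → Set (s ⊔ suc p)
  IsWellOrdered S = (P : Pred G.Carrier p) → P ⊆ S → Satisfiable P →
    ∃[ m ] (m ∈ P × (∀ x → x ∈ P → m G.≤ x))

  record Series : Set (suc p) where
    field
      coeff : G.Carrier → R.Carrier
      cong  : coeff Preserves G._≈_ ⟶ R._≈_

    support : Pred G.Carrier ℓ
    support x = ¬ (coeff x R.≈ R.0#)

    field
      support-wellOrdered : IsWellOrdered support

  open Series public

  infix 4 _≋_
  _≋_ : Rel Series (g ⊔ ℓ)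
  a ≋ b = ∀ x → coeff a x R.≈ coeff b x

  IsSum : (a b s : Series) → Set (g ⊔ ℓ)
  IsSum a b s = ∀ x → coeff s x R.≈ coeff a x R.+ coeff b x

  private
    G×G : Setoid g ℓ₁
    G×G = ×-setoid G.setoid G.setoid

    module M = Membership G×G
    module U = Uniqueness G×G

  -- The list is a repetition-free enumeration of the set
  -- { (x , y) | x ∈ support a, y ∈ support b, x ∙ y = z }.
  Enumerates : (a b : Series) → G.Carrier →
               List (G.Carrier × G.Carrier) → Set (g ⊔ ℓ₁ ⊔ ℓ)
  Enumerates a b z ps = U.Unique ps ×
    (∀ x y → ((x , y) M.∈ ps) ⇔
             (x ∈ support a × y ∈ support b × x G.∙ y G.≈ z))

  sumOver : (a b : Series) → List (G.Carrier × G.Carrier) → R.Carrier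
  sumOver a b ps =
    foldr R._+_ R.0# (map (λ (x , y) → coeff a x R.* coeff b y) ps)

  -- The linear extension of the multiplication of G: the coefficient of
  -- t at z is the sum of a_x b_y over all support pairs with x ∙ y = z.
  -- That this sum is finite is part of the assertion.
  IsProduct : (a b t : Series) → Set (g ⊔ ℓ₁ ⊔ ℓ)
  IsProduct a b t = ∀ z →
    ∃[ ps ] (Enumerates a b z ps × coeff t z R.≈ sumOver a b ps)

{-# OPTIONS --safe #-}
-- The two facts behind the theorem are due to Hahn and Neumann: for
-- well-ordered A and B the set AB is well-ordered, and every z has only
-- finitely many factorisations z = xy with x ∈ A, y ∈ B.  For the first,
-- given P ⊆ AB, take among the pairs whose product lies in P, below a given
-- bound, one with least y; passing to a smaller bound then decreases x.  For the
-- second, x determines y and reverses the order, so a nonempty set of left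
-- factors of z has a greatest as well as a least element.
-- The ring laws come down to the uniqueness of sums with finite support, and
-- associativity to summing (a x * b y) * d w over all triples with xyw = z in
-- two ways, grouped by (xy , w) and by (x , yw).
module Submission where

open import Defs
open import Level using (Lift; lift; lower; _⊔_)
open import Algebra.Bundles using (CommutativeMonoid; CommutativeRing)
open import Algebra.Core using (Op₁; Op₂)
open import Algebra.Properties.CommutativeSemigroup using (interchange)
import Algebra.Properties.Ring as RingProperties
open import Algebra.Structures using (IsMonoid; IsRing)
open import Axiom.ExcludedMiddle using (ExcludedMiddle)
open import Data.List.Base
  using (List; []; _∷_; _++_; concatMap; deduplicate; filter; foldr; map)
import Data.List.Membership.DecSetoid as DecMembership
import Data.List.Membership.Setoid as Membership
open import Data.List.Membership.Setoid.Properties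
  using (∈-++⁺ˡ; ∈-++⁺ʳ; ∈-concatMap⁺; ∈-deduplicate⁺; ∈-filter⁺; ∈-filter⁻;
         ∈-map⁺; ∈-resp-≈)
open import Data.List.Properties using (map-∘)
open import Data.List.Relation.Unary.All using (All; []; _∷_; tabulateₛ)
open import Data.List.Relation.Unary.AllPairs using ([]; _∷_)
open import Data.List.Relation.Unary.Any using (here; there)
import Data.List.Relation.Unary.Any as Any
import Data.List.Relation.Unary.Unique.DecSetoid.Properties as UniqueDec
import Data.List.Relation.Unary.Unique.Setoid as Uniqueness
import Data.List.Relation.Unary.Unique.Setoid.Properties as Unique
open import Data.Product.Base
  using (_×_; _,_; proj₁; proj₂; ∃₂; ∃-syntax; Σ-syntax)
open import Data.Product.Relation.Binary.Pointwise.NonDependent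
  using (×-decSetoid)
open import Data.Sum.Base using (_⊎_; inj₁; inj₂)
open import Function.Base using (_∘_; case_of_; const; id)
open import Function.Bundles using (mk⇔; Equivalence)
open import Relation.Binary.Bundles using (DecSetoid)
import Relation.Binary.Construct.NonStrictToStrict as ToStrict
open import Relation.Binary.Core using (_Preserves_⟶_)
open import Relation.Binary.PropositionalEquality.Core
  using () renaming (cong to ≡-cong)
open import Relation.Binary.Structures using (IsTotalOrder)
import Relation.Binary.Reasoning.Setoid as SetoidReasoning
open import Relation.Nullary.Decidable.Core
  using (Dec; yes; no; map′; decidable-stable)
open import Relation.Nullary.Negation using (¬_; contradiction)
open import Relation.Unary using (Pred; _∈_; _⊆_; Satisfiable; _∩_; _∪_)

-- Sums with finite support in a commutative monoid

module FiniteSum {c ℓ} (M : CommutativeMonoid c ℓ) where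

  open CommutativeMonoid M
    renaming ( Carrier to C; _∙_ to _+_; ε to 0#; ∙-cong to +-cong
             ; identityˡ to +-identityˡ; identityʳ to +-identityʳ)
  open SetoidReasoning setoid

  infixr 8 [_]·_

  -- The Iverson bracket, acting on summands: a constraint moves into the summand, so that sums over
  -- different index sets become sums over one list.
  [_]·_ : ∀ {p} {P : Set p} → Dec P → C → C
  [ yes _ ]· r = r
  [ no  _ ]· r = 0#

  module _ {p} {P : Set p} where

    []-yes : (d : Dec P) → P → ∀ {r} → [ d ]· r ≈ r
    []-yes (yes _)  _ = refl
    []-yes (no ¬p)  p = contradiction p ¬p

    []-no : (d : Dec P) → ¬ P → ∀ {r} → [ d ]· r ≈ 0#
    []-no (yes p) ¬p = contradiction p ¬p
    []-no (no _)  _  = refl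

    []-congʳ : (d : Dec P) → ∀ {r s} → r ≈ s → [ d ]· r ≈ [ d ]· s
    []-congʳ (yes _) r≈s = r≈s
    []-congʳ (no  _) _   = refl

    []-zero : (d : Dec P) → [ d ]· 0# ≈ 0#
    []-zero (yes _) = refl
    []-zero (no  _) = refl

    []-+ : (d : Dec P) → ∀ r s → [ d ]· (r + s) ≈ [ d ]· r + [ d ]· s
    []-+ (yes _) r s = refl
    []-+ (no  _) r s = sym (+-identityˡ 0#)

  []-cong : ∀ {p q} {P : Set p} {Q : Set q} (d : Dec P) (e : Dec Q) →
            (P → Q) → (Q → P) → ∀ {r s} → r ≈ s → [ d ]· r ≈ [ e ]· s
  []-cong (yes p) e f g r≈s = trans r≈s (sym ([]-yes e (f p)))
  []-cong (no ¬p) e f g r≈s = sym ([]-no e (¬p ∘ g))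

  ∑ : ∀ {a} {A : Set a} → (A → C) → List A → C
  ∑ f xs = foldr _+_ 0# (map f xs)

  module _ {a} {A : Set a} where

    ∑-congAll : ∀ {f h : A → C} {xs} → All (λ x → f x ≈ h x) xs →
                ∑ f xs ≈ ∑ h xs
    ∑-congAll []            = refl
    ∑-congAll (fx≈hx ∷ eqs) = +-cong fx≈hx (∑-congAll eqs)

    ∑-cong : ∀ {f h : A → C} → (∀ x → f x ≈ h x) → ∀ xs → ∑ f xs ≈ ∑ h xs
    ∑-cong f≈h []       = refl
    ∑-cong f≈h (x ∷ xs) = +-cong (f≈h x) (∑-cong f≈h xs)

    ∑-hom : ∀ {k : C → C} → k Preserves _≈_ ⟶ _≈_ → k 0# ≈ 0# →
            (∀ r s → k (r + s) ≈ k r + k s) →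
            ∀ (f : A → C) xs → k (∑ f xs) ≈ ∑ (k ∘ f) xs
    ∑-hom k-cong k-0 k-+ f []       = k-0
    ∑-hom k-cong k-0 k-+ f (x ∷ xs) =
      trans (k-+ _ _) (+-cong refl (∑-hom k-cong k-0 k-+ f xs))

    ∑-0 : ∀ (xs : List A) → ∑ (const 0#) xs ≈ 0#
    ∑-0 xs = sym (∑-hom {k = const 0#} (λ _ → refl) refl
                        (λ _ _ → sym (+-identityˡ 0#)) (const 0#) xs)

    ∑-+ : ∀ (f h : A → C) xs → ∑ (λ x → f x + h x) xs ≈ ∑ f xs + ∑ h xs
    ∑-+ f h []       = sym (+-identityˡ 0#)
    ∑-+ f h (x ∷ xs) = trans (+-cong refl (∑-+ f h xs))
      (interchange commutativeSemigroup (f x) (h x) (∑ f xs) (∑ h xs))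

  ∑-swap : ∀ {a b} {A : Set a} {B : Set b} (f : A → B → C) xs ys →
           ∑ (λ x → ∑ (f x) ys) xs ≈ ∑ (λ y → ∑ (λ x → f x y) xs) ys
  ∑-swap f []       ys = sym (∑-0 ys)
  ∑-swap f (x ∷ xs) ys = begin
    ∑ (f x) ys + ∑ (λ x → ∑ (f x) ys) xs         ≈⟨ +-cong refl (∑-swap f xs ys) ⟩
    ∑ (f x) ys + ∑ (λ y → ∑ (λ x → f x y) xs) ys ≈⟨ ∑-+ (f x) _ ys ⟨
    ∑ (λ y → f x y + ∑ (λ x → f x y) xs) ys      ∎

  -- Finite sums indexed by a decidable setoid

  module Support {x ℓx} (X : DecSetoid x ℓx) where

    open DecSetoid X public
      using (_≟_) renaming (Carrier to |X|; _≈_ to _≈ₓ_; setoid to S)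
    private module X = DecSetoid X
    open DecMembership X public using (_∈?_)
    open Membership S public using () renaming (_∈_ to _∈ₗ_; _∉_ to _∉ₗ_)
    open Uniqueness S public using () renaming (Unique to Unique)

    ∑-δ-∉ : ∀ {y xs} → y ∉ₗ xs → ∀ r → ∑ (λ x → [ y ≟ x ]· r) xs ≈ 0#
    ∑-δ-∉ {y} {xs} y∉xs r = trans
      (∑-congAll (tabulateₛ S λ {x} x∈xs →
        []-no (y ≟ x) λ y≈x → y∉xs (∈-resp-≈ S (X.sym y≈x) x∈xs)))
      (∑-0 xs)

    ∑-δ-∈ : ∀ {y xs} → Unique xs → y ∈ₗ xs → ∀ r →
            ∑ (λ x → [ y ≟ x ]· r) xs ≈ r
    ∑-δ-∈ {y} {x ∷ xs} x∷xs! (here y≈x) r = trans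
      (+-cong ([]-yes (y ≟ x) y≈x)
              (∑-δ-∉ (Unique.Unique[x∷xs]⇒x∉xs S x∷xs! ∘ ∈-resp-≈ S y≈x) r))
      (+-identityʳ r)
    ∑-δ-∈ {y} {x ∷ xs} x∷xs!@(_ ∷ xs!) (there y∈xs) r = trans
      (+-cong ([]-no (y ≟ x) λ y≈x →
                 Unique.Unique[x∷xs]⇒x∉xs S x∷xs! (∈-resp-≈ S y≈x y∈xs))
              (∑-δ-∈ xs! y∈xs r))
      (+-identityˡ r)

    -- The list may be larger than the support of `f`, which lets one list serve several functions.
    Covers : List |X| → (|X| → C) → Set (x ⊔ ℓx ⊔ ℓ)
    Covers xs f = ∀ x → x ∉ₗ xs → f x ≈ 0#

    -- A relation and not a function, since no covering list is canonical; for congruent `f`,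
    -- `hasSum-unique` makes the value independent of the choice.
    HasSum : (|X| → C) → C → Set (x ⊔ ℓx ⊔ ℓ)
    HasSum f r = ∃[ xs ] (Unique xs × Covers xs f × r ≈ ∑ f xs)

    ∑-δ : ∀ {xs f} → Unique xs → Covers xs f → ∀ y →
          ∑ (λ x → [ y ≟ x ]· f y) xs ≈ f y
    ∑-δ {xs} {f} xs! xs⊇f y with y ∈? xs
    ... | yes y∈xs = ∑-δ-∈ xs! y∈xs (f y)
    ... | no  y∉xs = trans (∑-δ-∉ y∉xs (f y)) (sym (xs⊇f y y∉xs))

    -- Expand each `f y` as a delta sum over `xs`, exchange the two sums, and collapse the sum over
    -- `ys`. No matching between the two lists has to be built.
    hasSum-over : ∀ {f r xs} → f Preserves _≈ₓ_ ⟶ _≈_ → HasSum f r →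
                  Unique xs → Covers xs f → r ≈ ∑ f xs
    hasSum-over {f} {r} {xs} f-cong (ys , ys! , ys⊇f , r≈) xs! xs⊇f = begin
      r                                        ≈⟨ r≈ ⟩
      ∑ f ys                                   ≈⟨ ∑-cong (∑-δ xs! xs⊇f) ys ⟨
      ∑ (λ y → ∑ (λ x → [ y ≟ x ]· f y) xs) ys ≈⟨ ∑-swap _ ys xs ⟩
      ∑ (λ x → ∑ (λ y → [ y ≟ x ]· f y) ys) xs ≈⟨ ∑-cong (λ x → ∑-cong (δ-sym x) ys) xs ⟩
      ∑ (λ x → ∑ (λ y → [ x ≟ y ]· f x) ys) xs ≈⟨ ∑-cong (∑-δ ys! ys⊇f) xs ⟩
      ∑ f xs                                   ∎
      where
      δ-sym : ∀ x y → [ y ≟ x ]· f y ≈ [ x ≟ y ]· f x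
      δ-sym x y with y ≟ x
      ... | yes y≈x = trans (f-cong y≈x) (sym ([]-yes (x ≟ y) (X.sym y≈x)))
      ... | no  y≉x = sym ([]-no (x ≟ y) (y≉x ∘ X.sym))

    hasSum-unique : ∀ {f r s} → f Preserves _≈ₓ_ ⟶ _≈_ →
                    HasSum f r → HasSum f s → r ≈ s
    hasSum-unique f-cong hr (_ , xs! , xs⊇f , s≈) =
      trans (hasSum-over f-cong hr xs! xs⊇f) (sym s≈)

    hasSum-cong : ∀ {f h r} → (∀ x → f x ≈ h x) → HasSum f r → HasSum h r
    hasSum-cong f≈h (xs , xs! , xs⊇f , r≈) =
      xs , xs! , (λ x x∉xs → trans (sym (f≈h x)) (xs⊇f x x∉xs)) ,
      trans r≈ (∑-cong f≈h xs)

    hasSum-hom : ∀ {k : C → C} → k Preserves _≈_ ⟶ _≈_ → k 0# ≈ 0# →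
                 (∀ r s → k (r + s) ≈ k r + k s) →
                 ∀ {f r} → HasSum f r → HasSum (k ∘ f) (k r)
    hasSum-hom k-cong k-0 k-+ {f} (xs , xs! , xs⊇f , r≈) =
      xs , xs! , (λ x x∉xs → trans (k-cong (xs⊇f x x∉xs)) k-0) ,
      trans (k-cong r≈) (∑-hom k-cong k-0 k-+ f xs)

    hasSum-singleton : ∀ {f} y → (∀ x → ¬ (x ≈ₓ y) → f x ≈ 0#) →
                       HasSum f (f y)
    hasSum-singleton y f≈0 =
      y ∷ [] , [] ∷ [] , (λ x x∉ → f≈0 x (x∉ ∘ here)) , sym (+-identityʳ _)

    private
      nub : List |X| → List |X|
      nub = deduplicate _≟_

      nub-! : ∀ xs → Unique (nub xs)
      nub-! = UniqueDec.deduplicate-! X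

    ∈-nub⁺ : ∀ {x xs} → x ∈ₗ xs → x ∈ₗ nub xs
    ∈-nub⁺ = ∈-deduplicate⁺ S _≟_ λ z≈y x≈y → X.trans x≈y (X.sym z≈y)

    covers⇒hasSum : ∀ {f xs} → Covers xs f → ∃[ r ] HasSum f r
    covers⇒hasSum {xs = xs} xs⊇f =
      _ , nub xs , nub-! xs , (λ x x∉ → xs⊇f x (x∉ ∘ ∈-nub⁺)) , refl

    hasSum-+ : ∀ {f h r s} → f Preserves _≈ₓ_ ⟶ _≈_ → h Preserves _≈ₓ_ ⟶ _≈_ →
               HasSum f r → HasSum h s → HasSum (λ x → f x + h x) (r + s)
    hasSum-+ {f} {h} f-cong h-cong hr@(xs , _ , xs⊇f , _) hs@(ys , _ , ys⊇h , _) =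
      zs , zs! ,
      (λ x x∉ → trans (+-cong (zs⊇f x x∉) (zs⊇h x x∉)) (+-identityˡ 0#)) ,
      trans (+-cong (hasSum-over f-cong hr zs! zs⊇f)
                    (hasSum-over h-cong hs zs! zs⊇h))
            (sym (∑-+ f h zs))
      where
      zs   = nub (xs ++ ys)
      zs!  = nub-! (xs ++ ys)
      zs⊇f : Covers zs f
      zs⊇f x x∉ = xs⊇f x (x∉ ∘ ∈-nub⁺ ∘ ∈-++⁺ˡ S)
      zs⊇h : Covers zs h
      zs⊇h x x∉ = ys⊇h x (x∉ ∘ ∈-nub⁺ ∘ ∈-++⁺ʳ S xs)

  -- Reindexing finite sums along maps

  module _ {x ℓx y ℓy} (X : DecSetoid x ℓx) (Y : DecSetoid y ℓy) where

    private
      module X = Support X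
      module Y = Support Y
      module Yₛ = DecSetoid Y

    -- Each `x` in `xs` finds `φ x` exactly once in `ys`, the image list without repetitions;
    -- inserting the bracket and exchanging the sums therefore groups the terms by fibres.
    hasSum-fibres : ∀ (φ : X.|X| → Y.|X|) → φ Preserves X._≈ₓ_ ⟶ Y._≈ₓ_ →
                    ∀ {f h r} → X.HasSum f r →
                    (∀ y → X.HasSum (λ x → [ φ x Y.≟ y ]· f x) (h y)) →
                    f Preserves X._≈ₓ_ ⟶ _≈_ →
                    Y.HasSum h r
    hasSum-fibres φ φ-cong {f} {h} {r} (xs , xs! , xs⊇f , r≈) fibres f-cong =
      ys , ys! , ys⊇h , (begin
        r                                            ≈⟨ r≈ ⟩
        ∑ f xs                                       ≈⟨ ∑-congAll (tabulateₛ X.S λ {x} x∈xs →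
                                                          ∑-δ-φ x∈xs) ⟨
        ∑ (λ x → ∑ (λ y → [ φ x Y.≟ y ]· f x) ys) xs ≈⟨ ∑-swap _ xs ys ⟩
        ∑ (λ y → ∑ (λ x → [ φ x Y.≟ y ]· f x) xs) ys ≈⟨ ∑-cong h≈ ys ⟨
        ∑ h ys                                       ∎)
      where
      ys  = deduplicate Y._≟_ (map φ xs)
      ys! = UniqueDec.deduplicate-! Y (map φ xs)

      ∑-δ-φ : ∀ {x} → x X.∈ₗ xs → ∑ (λ y → [ φ x Y.≟ y ]· f x) ys ≈ f x
      ∑-δ-φ {x} x∈xs =
        Y.∑-δ-∈ ys! (Y.∈-nub⁺ (∈-map⁺ X.S Y.S φ-cong x∈xs)) (f x)

      h≈ : ∀ y → h y ≈ ∑ (λ x → [ φ x Y.≟ y ]· f x) xs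
      h≈ y = X.hasSum-over
        (λ x≈x′ → []-cong (_ Y.≟ y) (_ Y.≟ y)
          (Yₛ.trans (Yₛ.sym (φ-cong x≈x′))) (Yₛ.trans (φ-cong x≈x′)) (f-cong x≈x′))
        (fibres y) xs!
        (λ x x∉ → trans ([]-congʳ (_ Y.≟ y) (xs⊇f x x∉)) ([]-zero (_ Y.≟ y)))

      ys⊇h : Y.Covers ys h
      ys⊇h y y∉ = trans (h≈ y) (trans
        (∑-congAll (tabulateₛ X.S λ {x} x∈xs → []-no (φ x Y.≟ y) λ φx≈y →
          y∉ (∈-resp-≈ Y.S φx≈y (Y.∈-nub⁺ (∈-map⁺ X.S Y.S φ-cong x∈xs)))))
        (∑-0 xs))

    -- Serves to identify a fibre of the triple sum with a sum over pairs. Injectivity keeps the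
    -- image list free of repetitions, and `off-image` makes it a cover.
    hasSum-injection : ∀ (ι : X.|X| → Y.|X|) → ι Preserves X._≈ₓ_ ⟶ Y._≈ₓ_ →
                       (∀ {x x′} → ι x Y.≈ₓ ι x′ → x X.≈ₓ x′) →
                       ∀ {f h r} → h Preserves Y._≈ₓ_ ⟶ _≈_ →
                       (∀ x → f x ≈ h (ι x)) →
                       (∀ y → h y ≈ 0# ⊎ ∃[ x ] (y Y.≈ₓ ι x)) →
                       X.HasSum f r → Y.HasSum h r
    hasSum-injection ι ι-cong ι-inj {f} {h} {r} h-cong f≈hι off-image
                     (xs , xs! , xs⊇f , r≈) =
      map ι xs , Unique.map⁺ X.S Y.S ι-inj xs! , covers , (begin
        r              ≈⟨ r≈ ⟩
        ∑ f xs         ≈⟨ ∑-cong f≈hι xs ⟩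
        ∑ (h ∘ ι) xs   ≡⟨ ≡-cong (foldr _+_ 0#) (map-∘ xs) ⟩
        ∑ h (map ι xs) ∎)
      where
      covers : Y.Covers (map ι xs) h
      covers y y∉ with off-image y
      ... | inj₁ hy≈0       = hy≈0
      ... | inj₂ (x , y≈ιx) = trans (h-cong y≈ιx) (trans (sym (f≈hι x)) (xs⊇f x λ x∈xs →
        y∉ (∈-resp-≈ Y.S (Yₛ.sym y≈ιx) (∈-map⁺ X.S Y.S ι-cong x∈xs))))

module MalcevNeumannRing {c ℓ g ℓ₁ ℓ₂} (em : ExcludedMiddle (c ⊔ ℓ ⊔ g ⊔ ℓ₁ ⊔ ℓ₂))
  (R : CommutativeRing c ℓ) (G : TotallyOrderedMonoid g ℓ₁ ℓ₂) where

  open MalcevNeumann R G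
  private
    module R where
      open CommutativeRing R public
      open RingProperties ring public using (-0#≈0#)

  open TotallyOrderedMonoid G using (_∙_; ε; isMonoid; ∙-monoʳ-<; ∙-monoˡ-<)
    renaming (Carrier to |G|; _≈_ to _≈ᴳ_; _≤_ to _≤ᴳ_; _<_ to _<ᴳ_)
  private
    module G where
      open IsMonoid isMonoid public using (∙-cong; assoc; identityˡ; identityʳ)
      open IsTotalOrder (TotallyOrderedMonoid.isTotalOrder G) public
        renaming (module Eq to ≈)

    p = c ⊔ ℓ ⊔ g ⊔ ℓ₁ ⊔ ℓ₂

  -- Products of well-ordered sets

  private
    infix 4 _≟ᴳ_
    _≟ᴳ_ : ∀ x y → Dec (x ≈ᴳ y)
    -- `em` decides statements at level `p` only, so statements at smaller levels are lifted first.
    x ≟ᴳ y = map′ lower (lift {ℓ = p}) em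

    infix 4 _<ᴳ?_
    _<ᴳ?_ : ∀ x y → Dec (x <ᴳ y)
    x <ᴳ? y = map′ lower (lift {ℓ = p}) em

    <⇒≱ : ∀ {x y} → x <ᴳ y → ¬ (y ≤ᴳ x)
    <⇒≱ = ToStrict.<⇒≱ _≈ᴳ_ _≤ᴳ_ G.antisym

    ≮⇒≥ : ∀ {x y} → ¬ (x <ᴳ y) → y ≤ᴳ x
    ≮⇒≥ = ToStrict.≮⇒≥ _≈ᴳ_ _≤ᴳ_ G.≈.sym _≟ᴳ_ G.reflexive G.total

    ≰⇒> : ∀ {x y} → ¬ (x ≤ᴳ y) → y <ᴳ x
    ≰⇒> = ToStrict.≰⇒> _≈ᴳ_ _≤ᴳ_ G.≈.sym G.reflexive G.total

    ∙-monoʳ-≤ : ∀ z {x y} → x ≤ᴳ y → z ∙ x ≤ᴳ z ∙ y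
    ∙-monoʳ-≤ z {x} {y} x≤y with x ≟ᴳ y
    ... | yes x≈y = G.reflexive (G.∙-cong G.≈.refl x≈y)
    ... | no  x≉y = proj₁ (∙-monoʳ-< z (x≤y , x≉y))

    ∙-monoˡ-≤ : ∀ z {x y} → x ≤ᴳ y → x ∙ z ≤ᴳ y ∙ z
    ∙-monoˡ-≤ z {x} {y} x≤y with x ≟ᴳ y
    ... | yes x≈y = G.reflexive (G.∙-cong x≈y G.≈.refl)
    ... | no  x≉y = proj₁ (∙-monoˡ-< z (x≤y , x≉y))

    ∙-cancelˡ-≤ : ∀ x {y y′} → x ∙ y ≤ᴳ x ∙ y′ → y ≤ᴳ y′
    ∙-cancelˡ-≤ x xy≤xy′ = ≮⇒≥ λ y′<y → <⇒≱ (∙-monoʳ-< x y′<y) xy≤xy′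

    ∙-cancelˡ : ∀ x {y y′} → x ∙ y ≈ᴳ x ∙ y′ → y ≈ᴳ y′
    ∙-cancelˡ x eq = G.antisym (∙-cancelˡ-≤ x (G.reflexive eq))
                               (∙-cancelˡ-≤ x (G.reflexive (G.≈.sym eq)))

    -- Otherwise `x ∙ y < x′ ∙ y ≤ x′ ∙ y′ ≤ x ∙ y`.
    ≤-from-products : ∀ {x y x′ y′} → y ≤ᴳ y′ → x′ ∙ y′ ≤ᴳ x ∙ y → x′ ≤ᴳ x
    ≤-from-products {x} {y} {x′} {y′} y≤y′ x′y′≤xy =
      ≮⇒≥ λ x<x′ → <⇒≱ (∙-monoˡ-< y x<x′) (G.trans (∙-monoʳ-≤ x′ y≤y′) x′y′≤xy)

  wellOrdered-⊆ : ∀ {s t} {S : Pred |G| s} {T : Pred |G| t} → S ⊆ T →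
                  IsWellOrdered T → IsWellOrdered S
  wellOrdered-⊆ S⊆T wo P P⊆S = wo P (S⊆T ∘ P⊆S)

  -- Minimal counterexample: the elements of `A` that violate `Φ` form a subset at level `p`, and
  -- its least element contradicts `step`.
  wellOrdered-induction : {A : Pred |G| p} → IsWellOrdered A → (Φ : Pred |G| p) →
    (∀ x → x ∈ A → (∀ x′ → x′ ∈ A → x′ <ᴳ x → Φ x′) → Φ x) →
    ∀ x → x ∈ A → Φ x
  wellOrdered-induction {A} woA Φ step x x∈A with em {Φ x}
  ... | yes Φx = Φx
  ... | no ¬Φx =
    let m , (m∈A , ¬Φm) , m-least = woA (λ x → x ∈ A × ¬ Φ x) proj₁ (x , x∈A , ¬Φx)
    in contradiction
         (step m m∈A λ x′ x′∈A x′<m → decidable-stable em λ ¬Φx′ →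
           <⇒≱ x′<m (m-least x′ (x′∈A , ¬Φx′)))
         ¬Φm

  -- If `P` meets `A`, let `m` be least in `P ∩ A`. Elements of `P` below `m` must lie in `B`; the
  -- least of these, or `m` if there are none, is least in `P`.
  wellOrdered-∪ : {A B : Pred |G| p} → IsWellOrdered A → IsWellOrdered B →
                  IsWellOrdered (A ∪ B)
  wellOrdered-∪ {A} {B} woA woB P P⊆A∪B P≠∅ with em {Satisfiable (P ∩ A)}
  ... | no  P∩A=∅ = woB P P⊆B P≠∅
    where
    P⊆B : P ⊆ B
    P⊆B {x} x∈P with P⊆A∪B x∈P
    ... | inj₁ x∈A = contradiction (x , x∈P , x∈A) P∩A=∅
    ... | inj₂ x∈B = x∈B
  ... | yes P∩A≠∅ with woA (P ∩ A) proj₂ P∩A≠∅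
  ...   | m , (m∈P , _) , m-least with em {∃[ x ] (x ∈ P × x <ᴳ m)}
  ...     | no  none = m , m∈P , λ x x∈P → ≮⇒≥ λ x<m → none (x , x∈P , x<m)
  ...     | yes (x₀ , x₀∈P , x₀<m) =
    let n , (n∈P , _ , lift n<m) , n-least =
          woB Q (proj₁ ∘ proj₂) (x₀ , x₀∈P , B∋ x₀∈P x₀<m , lift x₀<m)
    in n , n∈P , λ x x∈P → case x <ᴳ? m of λ where
         (yes x<m) → n-least x (x∈P , B∋ x∈P x<m , lift x<m)
         (no  x≮m) → G.trans (proj₁ n<m) (≮⇒≥ x≮m)
    where
    Q : Pred |G| p
    Q x = x ∈ P × x ∈ B × Lift p (x <ᴳ m)

    B∋ : ∀ {x} → x ∈ P → x <ᴳ m → x ∈ B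
    B∋ {x} x∈P x<m with P⊆A∪B x∈P
    ... | inj₁ x∈A = contradiction (m-least x (x∈P , x∈A)) (<⇒≱ x<m)
    ... | inj₂ x∈B = x∈B

  infixl 7 _·_
  _·_ : Pred |G| p → Pred |G| p → Pred |G| p
  (A · B) z = ∃₂ λ x y → x ∈ A × y ∈ B × x ∙ y ≈ᴳ z

  module _ {A B : Pred |G| p} (woA : IsWellOrdered A) (woB : IsWellOrdered B) where

    wellOrdered-· : IsWellOrdered (A · B)
    wellOrdered-· P P⊆AB (q₀ , q₀∈P) =
      let x , y , q , x∈A , y∈B , q∈P , xy≈q , _ , y-least = least-right q₀∈P
      in wellOrdered-induction woA Φ step x x∈A y q y∈B q∈P xy≈q y-least
      where
      Goal : Set p
      Goal = ∃[ m ] (m ∈ P × (∀ x → x ∈ P → m ≤ᴳ x))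

      -- Bounds the right factors of all elements of `P` up to `q`, and not only those of `q`, so
      -- that pairs chosen later for smaller bounds compare with `y`.
      LeastRight : |G| → |G| → Set p
      LeastRight q y = ∀ x′ y′ q′ → x′ ∈ A → y′ ∈ B → q′ ∈ P →
                       x′ ∙ y′ ≈ᴳ q′ → q′ ≤ᴳ q → y ≤ᴳ y′

      least-right : ∀ {q₀} → q₀ ∈ P → ∃[ x ] ∃[ y ] ∃[ q ]
        (x ∈ A × y ∈ B × q ∈ P × x ∙ y ≈ᴳ q × q ≤ᴳ q₀ × LeastRight q y)
      least-right {q₀} q₀∈P =
        let x , y , x∈A , y∈B , xy≈q₀ = P⊆AB q₀∈P
            m , (m∈B , x₁ , q₁ , x₁∈A , q₁∈P , x₁m≈q₁ , q₁≤q₀) , m-least =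
              woB (λ y → y ∈ B × ∃₂ λ x q → x ∈ A × q ∈ P × x ∙ y ≈ᴳ q × q ≤ᴳ q₀) proj₁
                  (y , y∈B , x , q₀ , x∈A , q₀∈P , xy≈q₀ , G.refl)
        in x₁ , m , q₁ , x₁∈A , m∈B , q₁∈P , x₁m≈q₁ , q₁≤q₀ ,
           λ x′ y′ q′ x′∈A y′∈B q′∈P eq q′≤q₁ →
             m-least y′ (y′∈B , x′ , q′ , x′∈A , q′∈P , eq , G.trans q′≤q₁ q₁≤q₀)

      -- The induction runs on the left factor alone; `y` and `q` are quantified because each step
      -- replaces the whole pair.
      Φ : Pred |G| p
      Φ x = ∀ y q → y ∈ B → q ∈ P → x ∙ y ≈ᴳ q → LeastRight q y → Goal

      step : ∀ x → x ∈ A → (∀ x′ → x′ ∈ A → x′ <ᴳ x → Φ x′) → Φ x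
      step x x∈A ih y q y∈B q∈P xy≈q y-least
        with em {∃[ q′ ] (q′ ∈ P × q′ <ᴳ q)}
      ... | no  none = q , q∈P , λ q′ q′∈P → ≮⇒≥ λ q′<q → none (q′ , q′∈P , q′<q)
      ... | yes (q₁ , q₁∈P , q₁<q) =
        -- The new pair is chosen below `q₁`. Since `q′ ≤ q`, minimality gives `y ≤ y′`; then
        -- `x ≤ x′` would yield `q ≤ q′ ≤ q₁ < q`.
        let x′ , y′ , q′ , x′∈A , y′∈B , q′∈P , x′y′≈q′ , q′≤q₁ , y′-least = least-right q₁∈P
            q′≤q = G.trans q′≤q₁ (proj₁ q₁<q)
            y≤y′ = y-least x′ y′ q′ x′∈A y′∈B q′∈P x′y′≈q′ q′≤q
            x′<x = ≰⇒> λ x≤x′ → <⇒≱ q₁<q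
              (G.trans (G.reflexive (G.≈.sym xy≈q))
              (G.trans (∙-monoˡ-≤ y x≤x′)
              (G.trans (∙-monoʳ-≤ x′ y≤y′)
              (G.trans (G.reflexive x′y′≈q′) q′≤q₁))))
        in ih x′ x′∈A x′<x y′ q′ y′∈B q′∈P x′y′≈q′ y′-least

  -- Finiteness of the set of factorisations

  private
    G-dec : DecSetoid g ℓ₁
    G-dec = record
      { isDecEquivalence = record { isEquivalence = G.isEquivalence ; _≟_ = _≟ᴳ_ } }

    G×G-dec : DecSetoid g ℓ₁
    G×G-dec = ×-decSetoid G-dec G-dec

    module G×G = DecSetoid G×G-dec

  open FiniteSum R.+-commutativeMonoid
  private module ∑G² = Support G×G-dec
  open ∑G² using (HasSum; _∈ₗ_; _≟_)

  module _ {A B : Pred |G| p} (woA : IsWellOrdered A) (woB : IsWellOrdered B)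
           (z : |G|) where

    private
      A′ : Pred |G| p
      A′ x = x ∈ A × ∃[ y ] (y ∈ B × x ∙ y ≈ᴳ z)

      -- The partner `m` of the least right factor `n` works: all products equal `z`, so a right
      -- factor at least `n` forces a left factor at most `m`.
      greatest : {Q : Pred |G| p} → Q ⊆ A′ → Satisfiable Q →
                 ∃[ m ] (m ∈ Q × (∀ x → x ∈ Q → x ≤ᴳ m))
      greatest {Q} Q⊆A′ (x , x∈Q) =
        let _ , y , y∈B , xy≈z = Q⊆A′ x∈Q
            n , (n∈B , m , m∈Q , mn≈z) , n-least =
              woB (λ y → y ∈ B × ∃[ x ] (x ∈ Q × x ∙ y ≈ᴳ z)) proj₁
                  (y , y∈B , x , x∈Q , xy≈z)
        in m , m∈Q , λ x x∈Q →
             let _ , y , y∈B , xy≈z = Q⊆A′ x∈Q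
             in ≤-from-products (n-least y (y∈B , x , x∈Q , xy≈z))
                                (G.reflexive (G.≈.trans xy≈z (G.≈.sym mn≈z)))

      -- A covering list suffices here; `enumeration` later removes repetitions and spurious pairs.
      Finite : Pred |G| p → Set p
      Finite Q = Lift p (∃[ ps ]
        (∀ x y → x ∈ Q → y ∈ B → x ∙ y ≈ᴳ z → (x , y) ∈ₗ ps))

      Below : |G| → Pred |G| p
      Below m x = x ∈ A′ × x <ᴳ m

      -- Split off the greatest element `m` of `Q`: by left cancellation it has a single right
      -- factor, and the rest of `Q` lies in `Below m`.
      finite-step : {Q : Pred |G| p} → Q ⊆ A′ →
                    (∀ m → m ∈ Q → Finite (Below m)) → Finite Q
      finite-step {Q} Q⊆A′ below with em {Satisfiable Q}
      ... | no  empty = lift ([] , λ x y x∈Q → contradiction (x , x∈Q) empty)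
      ... | yes Q≠∅ =
        let m , m∈Q , m-greatest = greatest Q⊆A′ Q≠∅
            _ , n , _ , mn≈z     = Q⊆A′ m∈Q
            lift (ps , covers)   = below m m∈Q
        in lift ((m , n) ∷ ps , λ x y x∈Q y∈B xy≈z → case x ≟ᴳ m of λ where
             (yes x≈m) → here (x≈m , ∙-cancelˡ x (G.≈.trans xy≈z (G.≈.sym
                           (G.≈.trans (G.∙-cong x≈m G.≈.refl) mn≈z))))
             (no  x≉m) → there
               (covers x y (Q⊆A′ x∈Q , m-greatest x x∈Q , x≉m) y∈B xy≈z))

    finite-factorisations :
      ∃[ ps ] (∀ x y → x ∈ A → y ∈ B → x ∙ y ≈ᴳ z → (x , y) ∈ₗ ps)
    finite-factorisations =
      -- The induction treats only the initial segments `Below m` with `m` in `A′`; one more step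
      -- covers `A′` itself.
      let lift (ps , covers) = finite-step id λ m m∈A′ → below m m∈A′
      in ps , λ x y x∈A y∈B xy≈z → covers x y (x∈A , y , y∈B , xy≈z) y∈B xy≈z
      where
      below : ∀ m → m ∈ A′ → Finite (Below m)
      below = wellOrdered-induction (wellOrdered-⊆ proj₁ woA) (Finite ∘ Below)
        λ x _ ih → finite-step proj₁ λ m m∈ → ih m (proj₁ m∈) (proj₂ m∈)

  -- The product of two series

  private
    infix 4 _≟⁰_
    _≟⁰_ : ∀ r s → Dec (r R.≈ s)
    r ≟⁰ s = map′ lower (lift {ℓ = p}) em

  -- The support raised to level `p`, where the lemmas on well-ordered sets are stated.
  supp : Series → Pred |G| p
  supp a x = Lift p (x ∈ support a)

  supp-wo : ∀ a → IsWellOrdered (supp a)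
  supp-wo a = wellOrdered-⊆ lower (support-wellOrdered a)

  -- With the constraint inside the summand, a coefficient of the product is a finitely supported
  -- sum over all of `|G| × |G|`.
  term : (a b : Series) → |G| → |G| × |G| → R.Carrier
  term a b z (x , y) = [ x ∙ y ≟ᴳ z ]· (coeff a x R.* coeff b y)

  term-cong : ∀ a b z → term a b z Preserves G×G._≈_ ⟶ R._≈_
  term-cong a b z (x≈ , y≈) = []-cong (_ ≟ᴳ z) (_ ≟ᴳ z)
    (G.≈.trans (G.≈.sym (G.∙-cong x≈ y≈))) (G.≈.trans (G.∙-cong x≈ y≈))
    (R.*-cong (cong a x≈) (cong b y≈))

  *-zero : ∀ a b {x y} → ¬ (x ∈ support a × y ∈ support b) →
           coeff a x R.* coeff b y R.≈ R.0#
  *-zero a b {x} {y} ∉ with coeff a x ≟⁰ R.0# | coeff b y ≟⁰ R.0#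
  ... | yes ax≈0 | _        = R.trans (R.*-congʳ ax≈0) (R.zeroˡ _)
  ... | no  _    | yes by≈0 = R.trans (R.*-congˡ by≈0) (R.zeroʳ _)
  ... | no  ax≉0 | no  by≉0 = contradiction (ax≉0 , by≉0) ∉

  -- Off the list either the bracket or one of the two coefficients vanishes.
  enumerates⇒hasSum : ∀ a b z {ps} → Enumerates a b z ps →
                      HasSum (term a b z) (sumOver a b ps)
  enumerates⇒hasSum a b z {ps} (ps! , ps-mem) = ps , ps! , covers ,
    ∑-congAll (tabulateₛ G×G.setoid λ {(x , y)} xy∈ps →
      R.sym ([]-yes (x ∙ y ≟ᴳ z) (proj₂ (proj₂ (Equivalence.to (ps-mem x y) xy∈ps)))))
    where
    covers : ∑G².Covers ps (term a b z)
    covers (x , y) xy∉ps with x ∙ y ≟ᴳ z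
    ... | no  _    = R.refl
    ... | yes xy≈z = *-zero a b λ (x∈ , y∈) →
      xy∉ps (Equivalence.from (ps-mem x y) (x∈ , y∈ , xy≈z))

  enumeration : ∀ a b z → ∃[ ps ] Enumerates a b z ps
  enumeration a b z = filter S? qs ,
    Unique.filter⁺ G×G.setoid S? (UniqueDec.deduplicate-! G×G-dec (proj₁ finite)) ,
    λ x y → mk⇔ (proj₂ ∘ ∈-filter⁻ G×G.setoid S? S-resp {xs = qs})
                (λ xy∈S@(x∈ , y∈ , xy≈z) → ∈-filter⁺ G×G.setoid S? S-resp
                  (∑G².∈-nub⁺ (proj₂ finite x y (lift x∈) (lift y∈) xy≈z)) xy∈S)
    where
    finite = finite-factorisations (supp-wo a) (supp-wo b) z
    qs     = deduplicate _≟_ (proj₁ finite)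

    S : Pred (|G| × |G|) (ℓ ⊔ ℓ₁)
    S (x , y) = x ∈ support a × y ∈ support b × x ∙ y ≈ᴳ z

    S? : ∀ xy → Dec (S xy)
    S? xy = map′ lower (lift {ℓ = p}) em

    S-resp : ∀ {xy xy′} → xy G×G.≈ xy′ → S xy → S xy′
    S-resp (x≈ , y≈) (x∈ , y∈ , xy≈z) =
      (x∈ ∘ R.trans (cong a x≈)) , (y∈ ∘ R.trans (cong b y≈)) ,
      G.≈.trans (G.≈.sym (G.∙-cong x≈ y≈)) xy≈z

  -- A nonzero sum has a nonempty list, whose first pair is already a factorisation of `z`.
  sumOver≉0⇒∈· : ∀ a b z {ps} → Enumerates a b z ps →
                 ¬ (sumOver a b ps R.≈ R.0#) → z ∈ supp a · supp b
  sumOver≉0⇒∈· a b z {[]}          _            ≉0 = contradiction R.refl ≉0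
  sumOver≉0⇒∈· a b z {(x , y) ∷ _} (_ , ps-mem) _  =
    let x∈ , y∈ , xy≈z = Equivalence.to (ps-mem x y) (here G×G.refl)
    in x , y , lift x∈ , lift y∈ , xy≈z

  _⊗_ : Op₂ Series
  a ⊗ b = record
    { coeff               = product
    ; cong                = product-cong
    ; support-wellOrdered = wellOrdered-⊆ support⊆·
                              (wellOrdered-· (supp-wo a) (supp-wo b))
    }
    where
    product : |G| → R.Carrier
    product z = sumOver a b (proj₁ (enumeration a b z))

    product-hasSum : ∀ z → HasSum (term a b z) (product z)
    product-hasSum z = enumerates⇒hasSum a b z (proj₂ (enumeration a b z))

    product-cong : product Preserves _≈ᴳ_ ⟶ R._≈_
    -- The enumerations at `z` and `z′` are chosen independently, but they sum functions that agree
    -- pointwise.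
    product-cong {z} {z′} z≈z′ = ∑G².hasSum-unique (term-cong a b z′)
      (∑G².hasSum-cong (λ _ → []-cong (_ ≟ᴳ z) (_ ≟ᴳ z′)
        (λ eq → G.≈.trans eq z≈z′) (λ eq → G.≈.trans eq (G.≈.sym z≈z′)) R.refl)
        (product-hasSum z))
      (product-hasSum z′)

    support⊆· : ∀ {z} → ¬ (product z R.≈ R.0#) → z ∈ supp a · supp b
    support⊆· {z} = sumOver≉0⇒∈· a b z (proj₂ (enumeration a b z))

  ⊗-isProduct : ∀ a b → IsProduct a b (a ⊗ b)
  ⊗-isProduct a b z =
    proj₁ (enumeration a b z) , proj₂ (enumeration a b z) , R.refl

  ⊗-hasSum : ∀ a b z → HasSum (term a b z) (coeff (a ⊗ b) z)
  ⊗-hasSum a b z = enumerates⇒hasSum a b z (proj₂ (enumeration a b z))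

  -- The common route to the multiplicative laws: exhibit the other side as a sum of the same
  -- `term`.
  ⊗-unique : ∀ a b z {r} → HasSum (term a b z) r → coeff (a ⊗ b) z R.≈ r
  ⊗-unique a b z = ∑G².hasSum-unique (term-cong a b z) (⊗-hasSum a b z)

  ⊗-cong : ∀ {a a′ b b′} → a ≋ a′ → b ≋ b′ → (a ⊗ b) ≋ (a′ ⊗ b′)
  ⊗-cong {a} {a′} {b} {b′} a≋a′ b≋b′ z = ⊗-unique a b z (∑G².hasSum-cong
    (λ (x , y) → []-congʳ (_ ≟ᴳ z) (R.*-cong (R.sym (a≋a′ x)) (R.sym (b≋b′ y))))
    (⊗-hasSum a′ b′ z))

  -- The additive group

  _⊕_ : Op₂ Series
  a ⊕ b = record
    { coeff               = λ x → coeff a x R.+ coeff b x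
    ; cong                = λ x≈y → R.+-cong (cong a x≈y) (cong b x≈y)
    ; support-wellOrdered = wellOrdered-⊆ support⊆∪
                              (wellOrdered-∪ (supp-wo a) (supp-wo b))
    }
    where
    support⊆∪ : ∀ {x} → ¬ (coeff a x R.+ coeff b x R.≈ R.0#) → x ∈ supp a ∪ supp b
    support⊆∪ {x} x∈ with coeff a x ≟⁰ R.0# | coeff b x ≟⁰ R.0#
    ... | no  a≉0 | _       = inj₁ (lift a≉0)
    ... | yes _   | no  b≉0 = inj₂ (lift b≉0)
    ... | yes a≈0 | yes b≈0 =
      contradiction (R.trans (R.+-cong a≈0 b≈0) (R.+-identityˡ _)) x∈

  ⊖_ : Op₁ Series
  ⊖ a = record
    { coeff               = λ x → R.- coeff a x
    ; cong                = λ x≈y → R.-‿cong (cong a x≈y)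
    ; support-wellOrdered = wellOrdered-⊆
        (λ -a≉0 a≈0 → -a≉0 (R.trans (R.-‿cong a≈0) R.-0#≈0#)) (support-wellOrdered a)
    }

  𝟘 : Series
  𝟘 = record
    { coeff               = const R.0#
    ; cong                = λ _ → R.refl
    ; support-wellOrdered = λ P P⊆∅ (x , x∈P) → contradiction R.refl (P⊆∅ x∈P)
    }

  𝟙 : Series
  𝟙 = record
    { coeff               = λ x → [ x ≟ᴳ ε ]· R.1#
    ; cong                = λ {x} {y} x≈y → []-cong (x ≟ᴳ ε) (y ≟ᴳ ε)
                              (G.≈.trans (G.≈.sym x≈y)) (G.≈.trans x≈y) R.refl
    -- The support contains at most `ε`, and nothing if `R` is trivial; any element of `P` is
    -- therefore least.
    ; support-wellOrdered = λ P P⊆ (x , x∈P) → x , x∈P , λ y y∈P →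
        G.reflexive (G.≈.trans (support⊆ε (P⊆ x∈P)) (G.≈.sym (support⊆ε (P⊆ y∈P))))
    }
    where
    support⊆ε : ∀ {x} → ¬ ([ x ≟ᴳ ε ]· R.1# R.≈ R.0#) → x ≈ᴳ ε
    support⊆ε {x} x∈ = decidable-stable (x ≟ᴳ ε) λ x≉ε → x∈ ([]-no (x ≟ᴳ ε) x≉ε)

  -- The ring laws

  distribˡ : ∀ a b d → (a ⊗ (b ⊕ d)) ≋ ((a ⊗ b) ⊕ (a ⊗ d))
  distribˡ a b d z = ⊗-unique a (b ⊕ d) z (∑G².hasSum-cong
    (λ (x , y) → R.trans (R.sym ([]-+ (x ∙ y ≟ᴳ z) _ _))
                         ([]-congʳ (x ∙ y ≟ᴳ z) (R.sym (R.distribˡ _ _ _))))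
    (∑G².hasSum-+ (term-cong a b z) (term-cong a d z) (⊗-hasSum a b z) (⊗-hasSum a d z)))

  distribʳ : ∀ d a b → ((a ⊕ b) ⊗ d) ≋ ((a ⊗ d) ⊕ (b ⊗ d))
  distribʳ d a b z = ⊗-unique (a ⊕ b) d z (∑G².hasSum-cong
    (λ (x , y) → R.trans (R.sym ([]-+ (x ∙ y ≟ᴳ z) _ _))
                         ([]-congʳ (x ∙ y ≟ᴳ z) (R.sym (R.distribʳ _ _ _))))
    (∑G².hasSum-+ (term-cong a d z) (term-cong b d z) (⊗-hasSum a d z) (⊗-hasSum b d z)))

  ⊗-identityˡ : ∀ a → (𝟙 ⊗ a) ≋ a
  ⊗-identityˡ a z = R.trans
    (⊗-unique 𝟙 a z (∑G².hasSum-singleton (ε , z) off))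
    (R.trans ([]-yes (ε ∙ z ≟ᴳ z) (G.identityˡ z))
    (R.trans (R.*-congʳ ([]-yes (ε ≟ᴳ ε) G.≈.refl)) (R.*-identityˡ _)))
    where
    off : ∀ xy → ¬ (xy G×G.≈ (ε , z)) → term 𝟙 a z xy R.≈ R.0#
    off (x , y) xy≉ with x ∙ y ≟ᴳ z
    ... | no  _    = R.refl
    -- Here `x ≈ ε` would give `y ≈ z`, so `𝟙` has coefficient zero at `x`.
    ... | yes xy≈z = R.trans
      (R.*-congʳ ([]-no (x ≟ᴳ ε) λ x≈ε → xy≉ (x≈ε ,
        G.≈.trans (G.≈.sym (G.identityˡ y))
        (G.≈.trans (G.∙-cong (G.≈.sym x≈ε) G.≈.refl) xy≈z))))
      (R.zeroˡ _)

  ⊗-identityʳ : ∀ a → (a ⊗ 𝟙) ≋ a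
  ⊗-identityʳ a z = R.trans
    (⊗-unique a 𝟙 z (∑G².hasSum-singleton (z , ε) off))
    (R.trans ([]-yes (z ∙ ε ≟ᴳ z) (G.identityʳ z))
    (R.trans (R.*-congˡ ([]-yes (ε ≟ᴳ ε) G.≈.refl)) (R.*-identityʳ _)))
    where
    off : ∀ xy → ¬ (xy G×G.≈ (z , ε)) → term a 𝟙 z xy R.≈ R.0#
    off (x , y) xy≉ with x ∙ y ≟ᴳ z
    ... | no  _    = R.refl
    ... | yes xy≈z = R.trans
      (R.*-congˡ ([]-no (y ≟ᴳ ε) λ y≈ε → xy≉
        (G.≈.trans (G.≈.sym (G.identityʳ x))
        (G.≈.trans (G.∙-cong G.≈.refl (G.≈.sym y≈ε)) xy≈z) , y≈ε)))
      (R.zeroʳ _)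

  -- Associativity of multiplication

  module _ (a b d : Series) (z : |G|) where

    private
      G³-dec = ×-decSetoid G×G-dec G-dec
      module G³ = DecSetoid G³-dec
      module ∑G³ = Support G³-dec

      term³ : G³.Carrier → R.Carrier
      term³ ((x , y) , w) =
        [ (x ∙ y) ∙ w ≟ᴳ z ]· ((coeff a x R.* coeff b y) R.* coeff d w)

      term³-cong : term³ Preserves G³._≈_ ⟶ R._≈_
      term³-cong ((x≈ , y≈) , w≈) = []-cong (_ ≟ᴳ z) (_ ≟ᴳ z)
        (G.≈.trans (G.≈.sym xyw≈)) (G.≈.trans xyw≈)
        (R.*-cong (R.*-cong (cong a x≈) (cong b y≈)) (cong d w≈))
        where xyw≈ = G.∙-cong (G.∙-cong x≈ y≈) w≈

      -- Factorise `z` as `u ∙ w`, then each `u` as `x ∙ y`. The first step needs the product of the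
      -- supports of `a` and `b` to be well-ordered.
      term³-covered : ∃[ ts ] ∑G³.Covers ts term³
      term³-covered = ts , covers
        where
        outer = finite-factorisations (wellOrdered-· (supp-wo a) (supp-wo b)) (supp-wo d) z
        inner = finite-factorisations (supp-wo a) (supp-wo b)

        triples : |G| × |G| → List G³.Carrier
        triples (u , w) = map (_, w) (proj₁ (inner u))

        ts = concatMap triples (proj₁ outer)

        ∈ts : ∀ {x y w} → x ∈ supp a → y ∈ supp b → w ∈ supp d →
              (x ∙ y) ∙ w ≈ᴳ z → ((x , y) , w) ∑G³.∈ₗ ts
        ∈ts {x} {y} {w} x∈ y∈ w∈ xyw≈z = ∈-concatMap⁺ G×G.setoid G³.setoid
          -- The list `outer` holds some `(u , w′)` equal to `(x ∙ y , w)` only up to the setoid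
          -- equality, so membership is transported from `w′` to `w`.
          (Any.map (λ {(u , w′)} (xy≈u , w≈w′) → ∈-resp-≈ G³.setoid
                     (G×G.refl , G.≈.sym w≈w′)
                     (∈-map⁺ G×G.setoid G³.setoid (_, G.≈.refl)
                       (proj₂ (inner u) x y x∈ y∈ xy≈u)))
                   (proj₂ outer (x ∙ y) w (x , y , x∈ , y∈ , G.≈.refl) w∈ xyw≈z))

        covers : ∑G³.Covers ts term³
        covers ((x , y) , w) ∉ts with (x ∙ y) ∙ w ≟ᴳ z
        ... | no  _     = R.refl
        ... | yes xyw≈z with coeff d w ≟⁰ R.0#
        ...   | yes dw≈0 = R.trans (R.*-congˡ dw≈0) (R.zeroʳ _)
        ...   | no  dw≉0 = R.trans
          (R.*-congʳ (*-zero a b λ (x∈ , y∈) →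
            ∉ts (∈ts (lift x∈) (lift y∈) (lift dw≉0) xyw≈z)))
          (R.zeroˡ _)

      term³-hasSum : ∃[ r ] ∑G³.HasSum term³ r
      term³-hasSum = ∑G³.covers⇒hasSum (proj₂ term³-covered)

      fibre-cong : (φ : G³.Carrier → |G| × |G|) → φ Preserves G³._≈_ ⟶ G×G._≈_ →
                   ∀ v → (λ t → [ φ t ≟ v ]· term³ t) Preserves G³._≈_ ⟶ R._≈_
      fibre-cong φ φ-cong v t≈t′ = []-cong (_ ≟ v) (_ ≟ v)
        (G×G.trans (G×G.sym (φ-cong t≈t′))) (G×G.trans (φ-cong t≈t′)) (term³-cong t≈t′)

      sum-by-xy : coeff ((a ⊗ b) ⊗ d) z R.≈ proj₁ term³-hasSum
      sum-by-xy = ⊗-unique (a ⊗ b) d z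
        (hasSum-fibres G³-dec G×G-dec φ φ-cong (proj₂ term³-hasSum) fibre term³-cong)
        where
        φ : G³.Carrier → |G| × |G|
        φ ((x , y) , w) = x ∙ y , w

        φ-cong : φ Preserves G³._≈_ ⟶ G×G._≈_
        φ-cong ((x≈ , y≈) , w≈) = G.∙-cong x≈ y≈ , w≈

        fibre : ∀ v → ∑G³.HasSum (λ t → [ φ t ≟ v ]· term³ t) (term (a ⊗ b) d z v)
        fibre (u , w) = hasSum-injection G×G-dec G³-dec
          (_, w) (_, G.≈.refl) proj₁ (fibre-cong φ φ-cong (u , w)) terms off
          -- This additive `k` carries the coefficient of `a ⊗ b` at `u` to the term of
          -- `(a ⊗ b) ⊗ d` at `(u , w)`.
          (∑G².hasSum-hom {k = λ s → [ u ∙ w ≟ᴳ z ]· (s R.* coeff d w)}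
            (λ r≈s → []-congʳ (u ∙ w ≟ᴳ z) (R.*-congʳ r≈s))
            (R.trans ([]-congʳ (u ∙ w ≟ᴳ z) (R.zeroˡ _)) ([]-zero (u ∙ w ≟ᴳ z)))
            (λ r s → R.trans ([]-congʳ (u ∙ w ≟ᴳ z) (R.distribʳ _ r s))
                             ([]-+ (u ∙ w ≟ᴳ z) _ _))
            (⊗-hasSum a b u))
          where
          terms : ∀ xy → [ u ∙ w ≟ᴳ z ]· (term a b u xy R.* coeff d w) R.≈
                         [ φ (xy , w) ≟ (u , w) ]· term³ (xy , w)
          -- If `x ∙ y ≈ u`, the conditions `u ∙ w ≈ z` and `(x ∙ y) ∙ w ≈ z` coincide; otherwise
          -- both sides vanish.
          terms (x , y) = case x ∙ y ≟ᴳ u of λ where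
            (yes xy≈u) → R.trans
              ([]-cong (u ∙ w ≟ᴳ z) ((x ∙ y) ∙ w ≟ᴳ z)
                (G.≈.trans (G.∙-cong xy≈u G.≈.refl))
                (G.≈.trans (G.∙-cong (G.≈.sym xy≈u) G.≈.refl))
                (R.*-congʳ ([]-yes (x ∙ y ≟ᴳ u) xy≈u)))
              (R.sym ([]-yes ((x ∙ y , w) ≟ (u , w)) (xy≈u , G.≈.refl)))
            (no xy≉u) → R.trans
              ([]-congʳ (u ∙ w ≟ᴳ z)
                (R.trans (R.*-congʳ ([]-no (x ∙ y ≟ᴳ u) xy≉u)) (R.zeroˡ _)))
              (R.trans ([]-zero (u ∙ w ≟ᴳ z))
                (R.sym ([]-no ((x ∙ y , w) ≟ (u , w)) (xy≉u ∘ proj₁))))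

          off : ∀ t → [ φ t ≟ (u , w) ]· term³ t R.≈ R.0# ⊎ ∃[ xy ] (t G³.≈ (xy , w))
          off t@(xy , w′) = case w′ ≟ᴳ w of λ where
            (yes w′≈w) → inj₂ (xy , G×G.refl , w′≈w)
            (no  w′≉w) → inj₁ ([]-no (φ t ≟ (u , w)) (w′≉w ∘ proj₂))

      sum-by-yw : coeff (a ⊗ (b ⊗ d)) z R.≈ proj₁ term³-hasSum
      sum-by-yw = ⊗-unique a (b ⊗ d) z
        (hasSum-fibres G³-dec G×G-dec φ φ-cong (proj₂ term³-hasSum) fibre term³-cong)
        where
        φ : G³.Carrier → |G| × |G|
        φ ((x , y) , w) = x , y ∙ w

        φ-cong : φ Preserves G³._≈_ ⟶ G×G._≈_
        φ-cong ((x≈ , y≈) , w≈) = x≈ , G.∙-cong y≈ w≈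

        fibre : ∀ v → ∑G³.HasSum (λ t → [ φ t ≟ v ]· term³ t) (term a (b ⊗ d) z v)
        fibre (x , v) = hasSum-injection G×G-dec G³-dec
          ι (λ (y≈ , w≈) → (G.≈.refl , y≈) , w≈) (λ ((_ , y≈) , w≈) → y≈ , w≈)
          (fibre-cong φ φ-cong (x , v)) terms off
          (∑G².hasSum-hom {k = λ s → [ x ∙ v ≟ᴳ z ]· (coeff a x R.* s)}
            (λ r≈s → []-congʳ (x ∙ v ≟ᴳ z) (R.*-congˡ r≈s))
            (R.trans ([]-congʳ (x ∙ v ≟ᴳ z) (R.zeroʳ _)) ([]-zero (x ∙ v ≟ᴳ z)))
            (λ r s → R.trans ([]-congʳ (x ∙ v ≟ᴳ z) (R.distribˡ _ r s))
                             ([]-+ (x ∙ v ≟ᴳ z) _ _))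
            (⊗-hasSum b d v))
          where
          ι : |G| × |G| → G³.Carrier
          ι (y , w) = (x , y) , w

          terms : ∀ yw → [ x ∙ v ≟ᴳ z ]· (coeff a x R.* term b d v yw) R.≈
                         [ φ (ι yw) ≟ (x , v) ]· term³ (ι yw)
          terms (y , w) = case y ∙ w ≟ᴳ v of λ where
            (yes yw≈v) →
              -- As `term³` is bracketed to the left, this grouping uses associativity in `G` for
              -- the constraint and in `R` for the coefficients.
              let xyw≈xv = G.≈.trans (G.assoc x y w) (G.∙-cong G.≈.refl yw≈v)
              in R.trans
                ([]-cong (x ∙ v ≟ᴳ z) ((x ∙ y) ∙ w ≟ᴳ z)
                  (G.≈.trans xyw≈xv) (G.≈.trans (G.≈.sym xyw≈xv))
                  (R.trans (R.*-congˡ ([]-yes (y ∙ w ≟ᴳ v) yw≈v)) (R.sym (R.*-assoc _ _ _))))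
                (R.sym ([]-yes ((x , y ∙ w) ≟ (x , v)) (G.≈.refl , yw≈v)))
            (no yw≉v) → R.trans
              ([]-congʳ (x ∙ v ≟ᴳ z)
                (R.trans (R.*-congˡ ([]-no (y ∙ w ≟ᴳ v) yw≉v)) (R.zeroʳ _)))
              (R.trans ([]-zero (x ∙ v ≟ᴳ z))
                (R.sym ([]-no ((x , y ∙ w) ≟ (x , v)) (yw≉v ∘ proj₂))))

          off : ∀ t → [ φ t ≟ (x , v) ]· term³ t R.≈ R.0# ⊎ ∃[ yw ] (t G³.≈ ι yw)
          off t@((x′ , y) , w) = case x′ ≟ᴳ x of λ where
            (yes x′≈x) → inj₂ ((y , w) , (x′≈x , G.≈.refl) , G.≈.refl)
            (no  x′≉x) → inj₁ ([]-no (φ t ≟ (x , v)) (x′≉x ∘ proj₁))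

    ⊗-assoc : coeff ((a ⊗ b) ⊗ d) z R.≈ coeff (a ⊗ (b ⊗ d)) z
    ⊗-assoc = R.trans sum-by-xy (R.sym sum-by-yw)

  -- The ring of Malcev-Neumann series

  isRing : IsRing _≋_ _⊕_ _⊗_ ⊖_ 𝟘 𝟙
  isRing = record
    { +-isAbelianGroup = record
      { isGroup = record
        { isMonoid = record
          { isSemigroup = record
            { isMagma = record
              { isEquivalence = record
                { refl  = λ _ → R.refl
                ; sym   = λ a≋b x → R.sym (a≋b x)
                ; trans = λ a≋b b≋d x → R.trans (a≋b x) (b≋d x)
                }
              ; ∙-cong = λ a≋a′ b≋b′ x → R.+-cong (a≋a′ x) (b≋b′ x)
              }
            ; assoc = λ a b d x → R.+-assoc _ _ _
            }
          ; identity = (λ a x → R.+-identityˡ _) , (λ a x → R.+-identityʳ _)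
          }
        ; inverse = (λ a x → R.-‿inverseˡ _) , (λ a x → R.-‿inverseʳ _)
        ; ⁻¹-cong = λ a≋b x → R.-‿cong (a≋b x)
        }
      ; comm = λ a b x → R.+-comm _ _
      }
    ; *-cong     = λ {a} {a′} {b} {b′} → ⊗-cong {a} {a′} {b} {b′}
    ; *-assoc    = ⊗-assoc
    ; *-identity = ⊗-identityˡ , ⊗-identityʳ
    ; distrib    = distribˡ , distribʳ
    }

mainTheorem13 : ∀ {c ℓ g ℓ₁ ℓ₂} → ExcludedMiddle (c ⊔ ℓ ⊔ g ⊔ ℓ₁ ⊔ ℓ₂) →
    (R : CommutativeRing c ℓ) (G : TotallyOrderedMonoid g ℓ₁ ℓ₂) →
    let open MalcevNeumann R G in
    Σ[ _⊕_ ∈ Op₂ Series ] Σ[ _⊗_ ∈ Op₂ Series ]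
    Σ[ ⊖_ ∈ Op₁ Series ] Σ[ 𝟘 ∈ Series ] Σ[ 𝟙 ∈ Series ]
    ((∀ a b → IsSum a b (a ⊕ b)) ×
    (∀ a b → IsProduct a b (a ⊗ b)) ×
    IsRing _≋_ _⊕_ _⊗_ ⊖_ 𝟘 𝟙)
mainTheorem13 em R G =
  _⊕_ , _⊗_ , ⊖_ , 𝟘 , 𝟙 , (λ a b x → R.refl) , ⊗-isProduct , isRing
  where
  module R = CommutativeRing R
  open MalcevNeumannRing em R G
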